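{- There exists a $2$-colouring of the edges of $\vec{K}_{\mathbb{N}}$, i.e. a map $c\colon E(\vec{K}_{\mathbb{N}})\to\{\text{red},\text{blue}\}$, such that every monochromatic directed path in $\vec{K}_{\mathbb{N}}$ has upper density $0$.
   Context: $\mathbb{N}$ denotes the positive integers. $\vec{K}_{\mathbb{N}}$ is the complete symmetric digraph on $\mathbb{N}$: its vertex set is $\mathbb{N}$ and its edges are all ordered pairs $(m,n)$ of distinct positive integers (so $(m,n)$ and $(n,m)$ are different edges and may receive different colours). The upper density of $A\subseteq\mathbb{N}$ is $\bar d(A)=\limsup_{n\to\infty}\frac{|A\cap\{1,\dots,n\}|}{n}$, and the upper density of a subgraph is that of its vertex set. A directed path is a finite or one-way infinite sequence of distinct vertices $v_1v_2\dots$ together with edges joining consecutive vertices that are all oriented in the same direction, i.e. either all edges are $(v_i,v_{i+1})$ (forward directed) or all edges are $(v_{i+1},v_i)$ (backward directed). It is monochromatic if all its edges have the same colour. -}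

module Defs where

open import Data.Fin.Base using (Fin; toℕ)
open import Data.Integer.Base using (+_)
open import Data.List.Base using (List; filter; length; map; upTo)
open import Data.Nat.Base using (ℕ; suc; NonZero; _≥_)
open import Data.Product.Base using (∃-syntax; _×_)
open import Data.Rational.Base using (ℚ; 0ℚ; _/_; _+_; _-_; _<_)
open import Function.Definitions using (Injective)
open import Level using (0ℓ)
open import Relation.Binary.PropositionalEquality.Core using (_≡_; _≢_)
open import Relation.Unary using (Pred; Decidable)

record ℕ⁺ : Set where
  constructor mkℕ⁺
  field
    value : ℕ
    .{{value≢0}} : NonZero value

open ℕ⁺ public

-- The proof of distinctness is irrelevant, so an edge is determined by
-- its two endpoints.
record Edge : Set where
  constructor edge
  field
    source : ℕ⁺
    target : ℕ⁺
    .distinct : source ≢ target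

open Edge public

data Colour : Set where
  red blue : Colour

Colouring : Set
Colouring = Edge → Colour

data Direction : Set where
  forward backward : Direction

-- `finite n` is the length of a path with n vertices.
data Length : Set where
  finite   : ℕ → Length
  infinite : Length

Position : Length → Set
Position (finite n) = Fin n
Position infinite   = ℕ

index : ∀ ℓ → Position ℓ → ℕ
index (finite n) i = toℕ i
index infinite   i = i

record DirectedPath : Set where
  field
    len       : Length
    direction : Direction
    vertex    : Position len → ℕ⁺
    injective : Injective _≡_ _≡_ vertex

open DirectedPath public

Joins : Direction → ℕ⁺ → ℕ⁺ → Edge → Set
Joins forward  u v e = source e ≡ u × target e ≡ v
Joins backward u v e = source e ≡ v × target e ≡ u

infix 4 _∈V_ _∈E_

_∈V_ : ℕ⁺ → DirectedPath → Set
v ∈V P = ∃[ i ] vertex P i ≡ v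

_∈E_ : Edge → DirectedPath → Set
e ∈E P = ∃[ i ] ∃[ j ] index (len P) j ≡ suc (index (len P) i)
                     × Joins (direction P) (vertex P i) (vertex P j) e

Monochromatic : Colouring → DirectedPath → Set
Monochromatic c P = ∃[ κ ] (∀ e → e ∈E P → c e ≡ κ)

[1‥_] : ℕ → List ℕ⁺
[1‥ n ] = map (λ i → mkℕ⁺ (suc i)) (upTo n)

count : {A : Pred ℕ⁺ 0ℓ} → Decidable A → ℕ → ℕ
count A? n = length (filter A? [1‥ n ])

density : {A : Pred ℕ⁺ 0ℓ} → Decidable A → ℕ⁺ → ℚ
density A? (mkℕ⁺ n) = + count A? n / n

-- The limit superior of a rational sequence, for rational values L of
-- the limit superior only.
IsLimsup : (ℕ⁺ → ℚ) → ℚ → Set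
IsLimsup a L = ∀ ε → 0ℚ < ε →
    (∃[ N ] (∀ n → value n ≥ N → a n < L + ε))
  × (∀ N → ∃[ n ] value n ≥ N × L - ε < a n)

HasUpperDensity : (A : Pred ℕ⁺ 0ℓ) → Decidable A → ℚ → Set
HasUpperDensity A A? δ = IsLimsup (density A?) δ

{-# OPTIONS --safe #-}

-- Compare positive integers by their binary digits, least significant first,
-- and colour an edge red or blue according to whether it goes up or down in
-- this order. The residues mod 2ᵏ form intervals of the order, so along a
-- monochromatic directed path they move monotonically through finitely many
-- values and are eventually constant. Hence, for every k, all but finitely
-- many vertices of the path lie in a single residue class mod 2ᵏ, which has
-- density 2⁻ᵏ.

module Submission where

open import Defs
open import Axiom.ExcludedMiddle using (ExcludedMiddle)
open import Data.Empty using (⊥-elim-irr)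
open import Data.Fin.Base as Fin using (zero; suc; fromℕ<)
open import Data.Fin.Properties using (pigeonhole; toℕ<n; fromℕ<-injective; toℕ-injective)
import Data.Integer.Base as ℤ
open import Data.Integer.Properties using (pos-*)
open import Data.List.Base using (List; length; lookup)
open import Data.List.Relation.Unary.All as All using (All)
import Data.List.Relation.Unary.All.Properties as All
open import Data.List.Relation.Unary.AllPairs using (_∷_)
open import Data.List.Relation.Unary.Unique.Propositional using (Unique)
open import Data.List.Relation.Unary.Unique.Propositional.Properties as Unique using (upTo⁺)
open import Data.List.Membership.Propositional.Properties using (∈-lookup)
open import Data.Nat.Base
open import Data.Nat.DivMod
open import Data.Nat.Induction using (<-wellFounded; Acc; acc)
open import Data.Nat.Properties
open import Data.Nat.Tactic.RingSolver using (solve-∀)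
open import Data.Product.Base using (∃-syntax; _×_; _,_)
open import Data.Rational.Base as ℚ using (0ℚ; mkℚ)
import Data.Rational.Properties as ℚ
import Data.Rational.Unnormalised.Base as ℚᵘ
import Data.Rational.Unnormalised.Properties as ℚᵘ
open import Data.Sum.Base using (_⊎_; inj₁; inj₂)
open import Level using (0ℓ)
open import Relation.Binary.Definitions using (tri<; tri≈; tri>)
open import Relation.Binary.PropositionalEquality
open import Relation.Nullary.Decidable.Core using (Dec; yes; no)
open import Relation.Nullary.Negation.Core using (¬_; contradiction)
open import Relation.Unary using (Pred; Decidable)

-- Reversed binary expansions.

infixl 7 _>>_

_>>_ : ℕ → ℕ → ℕ
m >> k = (m / 2 ^ k) {{m^n≢0 2 k}}

>>-suc : ∀ m k → m >> suc k ≡ (m >> k) / 2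
>>-suc m k = begin
  m >> suc k     ≡⟨ /-congʳ (*-comm 2 (2 ^ k)) ⟩
  m / (2 ^ k * 2) ≡⟨ m/n/o≡m/[n*o] m (2 ^ k) 2 ⟨
  (m >> k) / 2   ∎
  where
  open ≡-Reasoning
  instance
    _ = m^n≢0 2 k
    _ = m^n≢0 2 (suc k)
    _ = m*n≢0 (2 ^ k) 2

-- The number whose k-digit binary expansion is that of m mod 2ᵏ reversed.
rev : ℕ → ℕ → ℕ
rev zero    m = 0
rev (suc k) m = (m >> k) % 2 + rev k m * 2

prepend-mono-< : ∀ {b c r s} → b < 2 → r < s → b + r * 2 < c + s * 2
prepend-mono-< {b} {c} {r} {s} b<2 r<s = begin-strict
  b + r * 2 <⟨ +-monoˡ-< (r * 2) b<2 ⟩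
  suc r * 2 ≤⟨ *-monoˡ-≤ 2 r<s ⟩
  s * 2     ≤⟨ m≤n+m (s * 2) c ⟩
  c + s * 2 ∎
  where open ≤-Reasoning

rev<2^ : ∀ k m → rev k m < 2 ^ k
rev<2^ zero    m = z<s
rev<2^ (suc k) m = subst (rev (suc k) m <_) (*-comm (2 ^ k) 2)
  (prepend-mono-< {c = 0} (m%n<n (m >> k) 2) (rev<2^ k m))

-- Each further digit enters `rev` in the lowest place, so it cannot undo a strict inequality
-- settled by earlier digits.
rev-mono-< : ∀ {k l} m n → k ≤′ l → rev k m < rev k n → rev l m < rev l n
rev-mono-< m n ≤′-refl         lt = lt
rev-mono-< m n (≤′-step {l} k≤l) lt = prepend-mono-< (m%n<n (m >> l) 2) (rev-mono-< m n k≤l lt)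

-- More digits keep the inequality strict; with fewer it can at worst collapse to equality, since an
-- opposite strict inequality would persist up to `k`.
rev-<⇒≤ : ∀ {k} l m n → rev k m < rev k n → rev l m ≤ rev l n
rev-<⇒≤ {k} l m n lt with ≤-total k l
... | inj₁ k≤l = <⇒≤ (rev-mono-< m n (≤⇒≤′ k≤l) lt)
... | inj₂ l≤k = ≮⇒≥ λ gt → <-asym lt (rev-mono-< n m (≤⇒≤′ l≤k) gt)

%2-/2-injective : ∀ {m n} → m % 2 ≡ n % 2 → m / 2 ≡ n / 2 → m ≡ n
%2-/2-injective {m} {n} eq% eq/ = begin
  m                   ≡⟨ m≡m%n+[m/n]*n m 2 ⟩
  m % 2 + m / 2 * 2   ≡⟨ cong₂ (λ b r → b + r * 2) eq% eq/ ⟩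
  n % 2 + n / 2 * 2   ≡⟨ m≡m%n+[m/n]*n n 2 ⟨
  n                   ∎
  where open ≡-Reasoning

prepend-injectiveˡ : ∀ {b c} r s → b < 2 → c < 2 → b + r * 2 ≡ c + s * 2 → b ≡ c
prepend-injectiveˡ {b} {c} r s b<2 c<2 eq = begin
  b               ≡⟨ m<n⇒m%n≡m b<2 ⟨
  b % 2           ≡⟨ [m+kn]%n≡m%n b r 2 ⟨
  (b + r * 2) % 2 ≡⟨ cong (_% 2) eq ⟩
  (c + s * 2) % 2 ≡⟨ [m+kn]%n≡m%n c s 2 ⟩
  c % 2           ≡⟨ m<n⇒m%n≡m c<2 ⟩
  c               ∎
  where open ≡-Reasoning

rev->>-injective : ∀ k {m n} → rev k m ≡ rev k n → m >> k ≡ n >> k → m ≡ n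
rev->>-injective zero {m} {n} _ eq = trans (sym (n/1≡n m)) (trans eq (n/1≡n n))
-- Digit `k` is the lowest place of `rev (suc k) m` and the parity of `m >> k`; once known to agree,
-- it moves from the residue back to the quotient.
rev->>-injective (suc k) {m} {n} eqʳ eqˢ = rev->>-injective k
  (*-cancelʳ-≡ _ _ 2 (+-cancelˡ-≡ ((m >> k) % 2) _ _
    (trans eqʳ (cong (_+ rev k n * 2) (sym eqᵇ)))))
  (%2-/2-injective eqᵇ (trans (sym (>>-suc m k)) (trans eqˢ (>>-suc n k))))
  where
  eqᵇ : (m >> k) % 2 ≡ (n >> k) % 2
  eqᵇ = prepend-injectiveˡ (rev k m) (rev k n) (m%n<n (m >> k) 2) (m%n<n (n >> k) 2) eqʳ

n<2^n : ∀ n → n < 2 ^ n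
n<2^n zero    = z<s
n<2^n (suc n) = begin-strict
  suc n           ≤⟨ n<2^n n ⟩
  2 ^ n           <⟨ m<m+n (2 ^ n) (m^n>0 2 n) ⟩
  2 ^ n + 2 ^ n   ≡⟨ cong (2 ^ n +_) (+-identityʳ (2 ^ n)) ⟨
  2 ^ suc n       ∎
  where open ≤-Reasoning

>>-≡0 : ∀ {m k} → m ≤ k → m >> k ≡ 0
>>-≡0 {m} {k} m≤k = m<n⇒m/n≡0 {{m^n≢0 2 k}} (≤-<-trans m≤k (n<2^n k))

rev-injective : ∀ {k m n} → m ≤ k → n ≤ k → rev k m ≡ rev k n → m ≡ n
rev-injective {k} m≤k n≤k eq = rev->>-injective k eq (trans (>>-≡0 m≤k) (sym (>>-≡0 n≤k)))

-- The colouring.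

-- Since u, v < 2 ^ (u + v), the last u + v binary digits tell u and v apart.
Ascends : Edge → Set
Ascends (edge u v _) = rev (value u + value v) (value u) < rev (value u + value v) (value v)

ascends? : ∀ e → Dec (Ascends e)
ascends? (edge u v _) = _ <? _

colouring : Colouring
colouring e with ascends? e
... | yes _ = red
... | no  _ = blue

value-injective : ∀ {u v} → value u ≡ value v → u ≡ v
value-injective refl = refl

Ordered : Colour → ℕ → ℕ → Set
Ordered red  m n = m ≤ n
Ordered blue m n = n ≤ m

rev-ordered : ∀ k e → Ordered (colouring e) (rev k (value (source e))) (rev k (value (target e)))
rev-ordered k e@(edge u v u≢v) with ascends? e
... | yes lt = rev-<⇒≤ {value u + value v} k (value u) (value v) lt
... | no ¬lt with <-cmp (rev (value u + value v) (value u)) (rev (value u + value v) (value v))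
...   | tri< lt _ _ = contradiction lt ¬lt
-- With this many digits nothing is truncated, so a tie would make the endpoints equal.
...   | tri≈ _ eq _ = ⊥-elim-irr (u≢v (value-injective
        (rev-injective (m≤m+n (value u) (value v)) (m≤n+m (value v) (value u)) eq)))
...   | tri> _ _ gt = rev-<⇒≤ {value u + value v} k (value v) (value u) gt

-- Eventual constancy along a path.

ConstantFrom : ℕ → (ℕ → ℕ) → Set
ConstantFrom I g = ∀ i → I ≤ i → g i ≡ g I

antitone : (g : ℕ → ℕ) → (∀ i → g (suc i) ≤ g i) → ∀ {i j} → i ≤′ j → g j ≤ g i
antitone g step ≤′-refl        = ≤-refl
antitone g step (≤′-step i≤j) = ≤-trans (step _) (antitone g step i≤j)

Monotonic : (ℕ → ℕ) → Set
Monotonic g = (∀ i → g i ≤ g (suc i)) ⊎ (∀ i → g (suc i) ≤ g i)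

module _ (em : ExcludedMiddle 0ℓ) where

  -- Excluded middle decides whether a value below `g I` ever occurs; each such drop lowers a
  -- natural number, so the search terminates.
  antitone-constant : (g : ℕ → ℕ) → (∀ i → g (suc i) ≤ g i) → ∃[ I ] ConstantFrom I g
  antitone-constant g step = go 0 (<-wellFounded (g 0))
    where
    go : ∀ I → Acc _<_ (g I) → ∃[ I ] ConstantFrom I g
    go I (acc rs) with em {∃[ i ] g i < g I}
    ... | yes (i , lt) = go i (rs lt)
    ... | no ¬lt = I , λ i I≤i →
      ≤-antisym (antitone g step (≤⇒≤′ I≤i)) (≮⇒≥ λ lt → ¬lt (i , lt))

  monotone-constant : ∀ b (g : ℕ → ℕ) → (∀ i → g i ≤ b) → (∀ i → g i ≤ g (suc i)) → ∃[ I ] ConstantFrom I g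
  monotone-constant b g g≤b step =
    -- Reflection in `b` makes the sequence antitone; as no value exceeds `b`, the truncated
    -- subtraction cancels.
    let I , const = antitone-constant (λ i → b ∸ g i) (λ i → ∸-monoʳ-≤ b (step i))
    in  I , λ i I≤i → ∸-cancelˡ-≡ (g≤b i) (g≤b I) (const i I≤i)

  monotonic-constant : ∀ b (g : ℕ → ℕ) → (∀ i → g i ≤ b) → Monotonic g → ∃[ I ] ConstantFrom I g
  monotonic-constant b g g≤b (inj₁ step) = monotone-constant b g g≤b step
  monotonic-constant b g g≤b (inj₂ step) = antitone-constant g step

  rev-constant : ∀ P → Monochromatic colouring P → ∀ k →
    ∃[ I ] (∀ i j → I ≤ index (len P) i → I ≤ index (len P) j →
            rev k (value (vertex P i)) ≡ rev k (value (vertex P j)))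
  -- No position of a finite path reaches `n`, so the claim is vacuous.
  rev-constant record { len = finite n } _ k = n , λ i _ n≤i _ → contradiction (toℕ<n i) (≤⇒≯ n≤i)
  rev-constant P@record { len = infinite ; direction = d ; vertex = w ; injective = inj } (κ , mono) k =
    let I , const = monotonic-constant (2 ^ k) g (λ i → <⇒≤ (rev<2^ k _)) (monotonic d κ mono)
    in  I , λ i j I≤i I≤j → trans (const i I≤i) (sym (const j I≤j))
    where
    g : ℕ → ℕ
    g i = rev k (value (w i))

    ordered : ∀ {κ} e → colouring e ≡ κ → Ordered κ (rev k (value (source e))) (rev k (value (target e)))
    ordered e refl = rev-ordered k e

    up : ℕ → Edge
    up i = edge (w i) (w (suc i)) (λ eq → 1+n≢n (sym (inj eq)))

    down : ℕ → Edge
    down i = edge (w (suc i)) (w i) (λ eq → 1+n≢n (inj eq))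

    -- Blue and backward each reverse the order once: `g` rises weakly if both or neither occur, and
    -- falls weakly otherwise.
    monotonic : ∀ d κ → (∀ e → e ∈E record P { direction = d } → colouring e ≡ κ) → Monotonic g
    monotonic forward  red  m = inj₁ λ i → ordered (up i)   (m (up i)   (i , suc i , refl , refl , refl))
    monotonic forward  blue m = inj₂ λ i → ordered (up i)   (m (up i)   (i , suc i , refl , refl , refl))
    monotonic backward red  m = inj₂ λ i → ordered (down i) (m (down i) (i , suc i , refl , refl , refl))
    monotonic backward blue m = inj₁ λ i → ordered (down i) (m (down i) (i , suc i , refl , refl , refl))

-- Counting vertices and bounding the density.

index-injective : ∀ ℓ {i j : Position ℓ} → index ℓ i ≡ index ℓ j → i ≡ j
index-injective (finite n) = toℕ-injective
index-injective infinite   = λ eq → eq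

lookup-≢ : {A : Set} {xs : List A} → Unique xs → ∀ {i j} → i Fin.< j → lookup xs i ≢ lookup xs j
lookup-≢ (x∉xs ∷ _) {zero}  {suc j} _   = All.lookup x∉xs (∈-lookup j)
lookup-≢ (_ ∷ xs!)  {suc i} {suc j} i<j = lookup-≢ xs! (s<s⁻¹ i<j)

-- Pigeonhole. The code is read off a proof of `Q x`, later the position witnessing membership in
-- the path, so injectivity is asked across any two proofs.
length-≤-code : {A : Set} {Q : Pred A 0ℓ} {xs : List A} {M : ℕ} (code : ∀ {x} → Q x → ℕ) →
  (∀ {x} (q : Q x) → code q < M) → (∀ {x y} (p : Q x) (q : Q y) → code p ≡ code q → x ≡ y) →
  Unique xs → All Q xs → length xs ≤ M
length-≤-code code code<M inj xs! qs = ≮⇒≥ λ M<length →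
  let i , j , i<j , eq = pigeonhole M<length λ i → fromℕ< (code<M (All.lookup qs (∈-lookup i)))
  in  lookup-≢ xs! i<j (inj _ _ (fromℕ<-injective _ _ _ _ eq))

[1‥]-unique : ∀ n → Unique [1‥ n ]
[1‥]-unique n = Unique.map⁺ (λ eq → suc-injective (cong value eq)) (upTo⁺ n)

[1‥]-≤ : ∀ n → All (λ v → value v ≤ n) [1‥ n ]
[1‥]-≤ n = All.map⁺ (All.all-upTo n)

-- A vertex before position I is coded by its position, and a later one by its
-- quotient by 2ᵏ, which determines it because its residue is known.
count-≤ : ∀ P (_∈P? : Decidable (_∈V P)) k I →
  (∀ i j → I ≤ index (len P) i → I ≤ index (len P) j →
    rev k (value (vertex P i)) ≡ rev k (value (vertex P j))) →
  ∀ n → count _∈P? n ≤ I + suc (n >> k)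
count-≤ P _∈P? k I const n = length-≤-code code code< code-injective
  (Unique.filter⁺ _∈P? ([1‥]-unique n))
  (All.zip (All.all-filter _∈P? [1‥ n ] , All.filter⁺ _∈P? ([1‥]-≤ n)))
  where
  pos : Position (len P) → ℕ
  pos = index (len P)

  pos-injective : ∀ {i j} → pos i ≡ pos j → i ≡ j
  pos-injective = index-injective (len P)

  code : ∀ {v} → v ∈V P × value v ≤ n → ℕ
  code {v} ((i , _) , _) with pos i <? I
  ... | yes _ = pos i
  ... | no  _ = I + value v >> k

  code< : ∀ {v} (q : v ∈V P × value v ≤ n) → code q < I + suc (n >> k)
  code< ((i , _) , v≤n) with pos i <? I
  ... | yes i<I = <-≤-trans i<I (m≤m+n I _)
  ... | no  _   = +-monoʳ-< I (s≤s (/-monoˡ-≤ (2 ^ k) {{m^n≢0 2 k}} v≤n))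

  code-injective : ∀ {u v} (p : u ∈V P × value u ≤ n) (q : v ∈V P × value v ≤ n) →
                   code p ≡ code q → u ≡ v
  code-injective ((i , refl) , _) ((j , refl) , _) eq with pos i <? I | pos j <? I
  ... | yes _   | yes _   = cong (vertex P) (pos-injective eq)
  -- Early codes lie below `I` and late ones do not, so mixed cases are impossible.
  ... | yes i<I | no  _   = contradiction (subst (_< I) eq i<I) (m+n≮m I _)
  ... | no  _   | yes j<I = contradiction (subst (_< I) (sym eq) j<I) (m+n≮m I _)
  ... | no  i≮I | no  j≮I = value-injective
    (rev->>-injective k (const i j (≮⇒≥ i≮I) (≮⇒≥ j≮I)) (+-cancelˡ-≡ I _ _ eq))

-- A positive rational is at least the reciprocal of its denominator, and the hypothesis puts
-- `a / n` below that reciprocal.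
/-<-positive : ∀ a n .{{_ : NonZero n}} ε .{{_ : ℚ.Positive ε}} → a * ℚ.↧ₙ ε < n → ℤ.+ a ℚ./ n ℚ.< ε
/-<-positive a (suc n) (mkℚ ℤ.+[1+ p ] q _) aq<n = ℚ.toℚᵘ-cancel-<
  (ℚᵘ.<-respˡ-≃ (ℚᵘ.≃-sym (ℚ.toℚᵘ-fromℚᵘ (ℚᵘ.mkℚᵘ (ℤ.+ a) n)))
    (ℚᵘ.*<* (subst₂ ℤ._<_ (pos-* a (suc q)) (pos-* (suc p) (suc n))
      (ℤ.+<+ (<-≤-trans aq<n (m≤n*m (suc n) (suc p)))))))

-- As `2 ^ (2 * q)` exceeds `2 * q`, the residue class contributes at most half of the allowed
-- `n / q`; the other half absorbs `suc I` once `n` is large.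
frequency-bound : ∀ c I q n → c ≤ I + suc (n >> (2 * q)) →
  2 * q * suc I < n → c * q < n
frequency-bound c I q n c≤ large = *-cancelˡ-< 2 _ _ (begin-strict
  2 * (c * q)                                    ≤⟨ *-monoʳ-≤ 2 (*-monoˡ-≤ q c≤) ⟩
  2 * ((I + suc h) * q)                          ≡⟨ rearrange I h q ⟩
  2 * q * suc I + h * (2 * q)                    ≤⟨ +-monoʳ-≤ _ (*-monoʳ-≤ h (<⇒≤ (n<2^n (2 * q)))) ⟩
  2 * q * suc I + h * 2 ^ (2 * q)                ≤⟨ +-monoʳ-≤ _ (m/n*n≤m n (2 ^ (2 * q)) {{m^n≢0 2 (2 * q)}}) ⟩
  2 * q * suc I + n                              <⟨ +-monoˡ-< n large ⟩
  n + n                                          ≡⟨ cong (n +_) (+-identityʳ n) ⟨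
  2 * n                                          ∎)
  where
  open ≤-Reasoning
  h = n >> (2 * q)
  rearrange : ∀ I h q → 2 * ((I + suc h) * q) ≡ 2 * q * suc I + h * (2 * q)
  rearrange = solve-∀

0-ε<density : {A : Pred ℕ⁺ 0ℓ} (A? : Decidable A) → ∀ {ε} → 0ℚ ℚ.< ε → ∀ n → 0ℚ ℚ.- ε ℚ.< density A? n
0-ε<density A? {ε} 0<ε (mkℕ⁺ n) = ℚ.<-≤-trans
  (subst (ℚ._< 0ℚ) (sym (ℚ.+-identityˡ (ℚ.- ε))) (ℚ.neg-antimono-< 0<ε))
  (ℚ.nonNegative⁻¹ _ {{ℚ.normalize-nonNeg (count A? n) n}})

theorem1p2 : (em : ExcludedMiddle 0ℓ) →
    ∃[ c ] (∀ (P : DirectedPath) → Monochromatic c P →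
    HasUpperDensity (λ v → v ∈V P) (λ v → em) 0ℚ)
theorem1p2 em = colouring , λ P mono ε 0<ε →
  eventually-below P mono ε 0<ε ,
  -- Densities are nonnegative, so any index from `N` on serves; `suc N` is also positive.
  λ N → mkℕ⁺ (suc N) , n≤1+n N , 0-ε<density (λ v → em) 0<ε (mkℕ⁺ (suc N))
  where
  eventually-below : ∀ P → Monochromatic colouring P → ∀ ε → 0ℚ ℚ.< ε →
    ∃[ N ] (∀ n → value n ≥ N → density {_∈V P} (λ v → em) n ℚ.< 0ℚ ℚ.+ ε)
  eventually-below P mono ε 0<ε =
    let q         = ℚ.↧ₙ ε
        k         = 2 * q
        I , const = rev-constant em P mono k
    in  suc (k * suc I) , λ { (mkℕ⁺ n) large →
          subst (_ ℚ.<_) (sym (ℚ.+-identityˡ ε))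
            (/-<-positive (count {_∈V P} (λ v → em) n) n ε {{ℚ.positive 0<ε}}
              (frequency-bound _ I q n (count-≤ P (λ v → em) k I const n) large)) }
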